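{- Let $G$ be a finite graph that admits a Kasteleyn signing (for example, any planar graph). If $C_1,\dots,C_n$ are channels of $G$ that are linearly independent in the $\mathbf{Z}/2\mathbf{Z}$-vector space $\mathcal{C}(G)$, then $2^n$ divides $m_G^2$. In particular, $|\mathcal{C}(G)|$ divides $m_G^2$. If moreover $G$ is bipartite and admits a bipartite Kasteleyn signing (for example, $G$ is bipartite and planar), and $C_1,\dots,C_n\in\mathcal{C}_B(G)$ are linearly independent, then $2^n$ divides $m_G$.
   Context: All graphs are finite, undirected, without self-loops, with at most one edge between two vertices. $m_G$ denotes the number of perfect matchings of $G$. For a vertex $v$, $N(v)$ is its set of neighbours. A channel of $G=(V,E)$ is a set $C\subseteq V$ such that $|N(v)\cap C|$ is even for every $v\in V$ (the empty set is a channel). $\mathcal{C}(G)$ is the set of channels; it is a vector space over $\mathbf{Z}/2\mathbf{Z}$ with addition given by symmetric difference. If $G$ is bipartite with vertices colored black and white, $\mathcal{C}_B(G)$ (resp. $\mathcal{C}_W(G)$) denotes the subspace of channels consisting only of black (resp. white) vertices. A Kasteleyn signing of $G$ with adjacency matrix $A=(a_{ij})$ is a matrix $K=(\pm a_{ij})$ (obtained by changing signs of some entries) with $\det K=m_G^2$. For bipartite $G$, the bipartite adjacency matrix $B$ is the submatrix of $A$ with rows indexed by white and columns by black vertices; a bipartite Kasteleyn signing is a matrix $H=(\pm b_{ij})$ with $\det H=m_G$ (when $B$ is square; if $B$ is not square, $m_G=0$). -}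

module Defs where

open import Data.Bool using (Bool; true; false; if_then_else_; T; T?; _xor_)
open import Data.Fin using (Fin; zero; suc; toℕ; cast; _<_; _<?_; _≟_)
open import Data.Fin.Properties using (all?)
open import Data.Fin.Subset using (Subset; inside; outside; ⊥; _∩_; ∣_∣; _∈_)
open import Data.Integer as ℤ using (ℤ; +_; -_; 0ℤ; 1ℤ; -1ℤ)
import Data.Integer.Properties as ℤ
open import Data.List using (List; []; _∷_; [_]; _++_; map; filter; length; lookup; allFin; cartesianProduct)
open import Data.Nat as ℕ using (ℕ; zero; suc)
open import Data.Nat.Divisibility using (_∣_; _∣?_)
open import Data.Product using (_×_; _,_; proj₁; proj₂; ∃)
open import Data.Sum using (_⊎_)
open import Data.Vec as Vec using (tabulate; zipWith)
open import Data.Vec.Functional using (Vector; removeAt; foldr)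
open import Relation.Binary.Definitions using (DecidableEquality)
open import Relation.Binary.PropositionalEquality using (_≡_; _≢_; refl)
open import Relation.Nullary using (Dec; yes; no; does; _×-dec_; _⊎-dec_)
open import Relation.Unary using (Pred; Decidable)
open import Level using (0ℓ)

import Algebra.Properties.CommutativeMonoid.Sum ℤ.+-0-commutativeMonoid as Sum

Matrix : ℕ → ℕ → Set
Matrix m n = Fin m → Fin n → ℤ

-- Cofactor expansion along the first row; the empty determinant is 1.
det : ∀ {n} → Matrix n n → ℤ
det {zero}  M = 1ℤ
det {suc n} M = Sum.sum λ j →
  (-1ℤ ℤ.^ toℕ j) ℤ.* M zero j ℤ.* det (λ i → removeAt (M (suc i)) j)

IsSigningOf : ∀ {m n} → Matrix m n → Matrix m n → Set
IsSigningOf A K = ∀ i j → (K i j ≡ A i j) ⊎ (K i j ≡ - A i j)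

-- Each subset is listed exactly once.
subsets : ∀ n → List (Subset n)
subsets zero    = [ Vec.[] ]
subsets (suc n) = map (outside Vec.∷_) (subsets n) ++ map (inside Vec.∷_) (subsets n)

#subsets : ∀ {n} {P : Pred (Subset n) 0ℓ} → Decidable P → ℕ
#subsets {n} P? = length (filter P? (subsets n))

_△_ : ∀ {n} → Subset n → Subset n → Subset n
_△_ = zipWith _xor_

-- Coefficients in ℤ/2 are Booleans (true = 1).
combination : ∀ {n k} → Vector Bool n → Vector (Subset k) n → Subset k
combination ε C = foldr _△_ ⊥ (λ i → if ε i then C i else ⊥)

LinearlyIndependent : ∀ {n k} → Vector (Subset k) n → Set
LinearlyIndependent C = ∀ ε → combination ε C ≡ ⊥ → ∀ i → ε i ≡ false

record Graph (N : ℕ) : Set where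
  field
    adj        : Fin N → Fin N → Bool
    adj-sym    : ∀ u v → adj u v ≡ adj v u
    adj-irrefl : ∀ v → adj v v ≡ false

module _ {N : ℕ} (G : Graph N) where
  open Graph G

  -- Each undirected edge is listed once, with its smaller endpoint first.
  edges : List (Fin N × Fin N)
  edges = filter (λ (u , v) → (u <? v) ×-dec T? (adj u v))
                 (cartesianProduct (allFin N) (allFin N))

  EdgeSet : Set
  EdgeSet = Subset (length edges)

  edgesAt : Fin N → EdgeSet
  edgesAt v = tabulate λ e → does ((v ≟ proj₁ (lookup edges e)) ⊎-dec (v ≟ proj₂ (lookup edges e)))

  IsPerfectMatching : Pred EdgeSet 0ℓ
  IsPerfectMatching M = ∀ v → ∣ M ∩ edgesAt v ∣ ≡ 1

  isPerfectMatching? : Decidable IsPerfectMatching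
  isPerfectMatching? M = all? λ v → ∣ M ∩ edgesAt v ∣ ℕ.≟ 1

  #perfectMatchings : ℕ
  #perfectMatchings = #subsets isPerfectMatching?

  neighbours : Fin N → Subset N
  neighbours v = tabulate (adj v)

  IsChannel : Pred (Subset N) 0ℓ
  IsChannel C = ∀ v → 2 ∣ ∣ neighbours v ∩ C ∣

  isChannel? : Decidable IsChannel
  isChannel? C = all? λ v → 2 ∣? ∣ neighbours v ∩ C ∣

  #channels : ℕ
  #channels = #subsets isChannel?

  adjacency : Matrix N N
  adjacency u v = if adj u v then 1ℤ else 0ℤ

  IsKasteleynSigning : Matrix N N → Set
  IsKasteleynSigning K = IsSigningOf adjacency K × det K ≡ + (#perfectMatchings ℕ.^ 2)

data Colour : Set where
  black white : Colour

_≟ᶜ_ : DecidableEquality Colour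
black ≟ᶜ black = yes refl
black ≟ᶜ white = no λ ()
white ≟ᶜ black = no λ ()
white ≟ᶜ white = yes refl

IsProperColouring : ∀ {N} → Graph N → (Fin N → Colour) → Set
IsProperColouring G colour = ∀ u v → T (Graph.adj G u v) → colour u ≢ colour v

module _ {N : ℕ} (G : Graph N) (colour : Fin N → Colour) where

  verticesOf : Colour → List (Fin N)
  verticesOf c = filter (λ v → colour v ≟ᶜ c) (allFin N)

  #white #black : ℕ
  #white = length (verticesOf white)
  #black = length (verticesOf black)

  -- White rows and black columns, each in the order induced from Fin N.  Another
  -- order changes det at most by a sign, which negating one row of a signing undoes.
  bipartiteAdjacency : Matrix #white #black
  bipartiteAdjacency i j = adjacency G (lookup (verticesOf white) i) (lookup (verticesOf black) j)

  -- The determinant condition applies only when the matrix is square; a non-square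
  -- one forces the number of perfect matchings to be 0, and any signing qualifies.
  IsBipartiteKasteleynSigning : Matrix #white #black → Set
  IsBipartiteKasteleynSigning H =
    IsSigningOf bipartiteAdjacency H ×
    ((square : #white ≡ #black) →
       det (λ i j → H i (cast square j)) ≡ + #perfectMatchings G)

  IsBlackChannel : Pred (Subset N) 0ℓ
  IsBlackChannel C = IsChannel G C × (∀ v → v ∈ C → colour v ≡ black)

{-# OPTIONS --safe #-}

-- A channel is a vector in the kernel mod 2 of the adjacency matrix, hence of every signing K of it.
-- If c₁, …, cₙ are independent vectors in the kernel of K mod 2 and c₁ has a 1 in position j, then
-- replacing column j of K by the combination of the columns with coefficients c₁ leaves det K unchanged
-- and makes that column even.  Halving it takes out a factor 2, and c₂, …, cₙ, cleared at position j by
-- adding c₁, are still in the kernel of the new matrix; so 2ⁿ divides det K.  In the bipartite case the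
-- black channels are in the kernel of H, unless the colour classes differ in size and m_G = 0.

module Submission where

open import Defs
open import Algebra using (CommutativeRing)
open import Data.Bool using (Bool; true; false; if_then_else_; _xor_; _∧_; T)
import Data.Bool.Properties as Bool
open import Data.Fin using (Fin; zero; suc; toℕ; cast; inject₁; punchIn; punchOut; _<_; _≟_)
open import Data.Fin.Induction using (<-weakInduction)
open import Data.Fin.Permutation using (Permutation; permutation)
open import Data.Fin.Properties as Fin using (punchInᵢ≢i; punchIn-punchOut; punchIn-injective; ¬∀⟶∃¬; <-cmp)
open import Data.Fin.Subset as Subset using (Subset; inside; outside; ∣_∣; _∩_)
open import Data.Fin.Subset.Properties using (anySubset?; ∩-comm)
open import Data.Integer as ℤ using (ℤ; +_; -_; 0ℤ; 1ℤ; -1ℤ; _+_; _*_; _-_)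
import Data.Integer.Divisibility.Signed as ℤ
import Data.Integer.Properties as ℤ
open import Data.Integer.Tactic.RingSolver using (solve-∀)
open import Data.List as List using (List; []; _∷_; map; filter; length; allFin)
open import Data.List.Membership.Propositional.Properties using (∈-filter⁺; ∈-allFin; ∈-lookup)
open import Data.List.Properties using (filter-++; length-++; filter-none; filter-≐)
import Data.List.Relation.Unary.All as All
open import Data.List.Relation.Unary.All.Properties using (all-filter)
open import Data.List.Relation.Unary.Any using (index)
open import Data.List.Relation.Unary.Any.Properties using (lookup-index)
open import Data.Nat as ℕ using (ℕ; zero; suc; s≤s; _^_)
open import Data.Nat.Divisibility using (_∣_; _∣0)
import Data.Nat.Properties as ℕ
open import Data.Product using (_×_; _,_; proj₁; proj₂; ∃)
open import Data.Sum using (_⊎_; inj₁; inj₂)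
open import Data.Vec as Vec using (_∷_; []; tabulate; lookup)
open import Data.Vec.Functional using (Vector; removeAt; updateAt)
open import Data.Vec.Functional.Properties using (updateAt-updates; updateAt-minimal)
open import Data.Vec.Properties using (lookup-zipWith; lookup-replicate; tabulate∘lookup; tabulate-cong; lookup⇒[]=)
open import Function using (_∘_; const)
open import Level using (0ℓ)
open import Relation.Binary.Definitions using (tri<; tri≈; tri>)
open import Relation.Binary.PropositionalEquality
open import Relation.Nullary using (Dec; ¬_; yes; no; does; contradiction; _⊎-dec_)
open import Relation.Nullary.Decidable using (dec-true)
open import Relation.Unary using (Pred; Decidable; _≐_)

open import Algebra.Properties.Semiring.Sum ℤ.+-*-semiring

-- Determinants under adjacent column swaps and with equal columns.

det-cong : ∀ {n} {M M′ : Matrix n n} → (∀ i j → M i j ≡ M′ i j) → det M ≡ det M′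
det-cong {zero}  M≗M′ = refl
det-cong {suc n} M≗M′ = sum-cong-≗ λ j →
  cong₂ _*_ (cong ((-1ℤ ℤ.^ toℕ j) *_) (M≗M′ zero j))
            (det-cong λ i k → M≗M′ (suc i) (punchIn j k))

-- The transposition of `inject₁ i` and `suc i`. It recurses in the same way as `punchIn`, so that
-- the two can be commuted by case analysis.
swapAt : ∀ {n} → Fin n → Fin (suc n) → Fin (suc n)
swapAt zero    zero          = suc zero
swapAt zero    (suc zero)    = zero
swapAt zero    (suc (suc k)) = suc (suc k)
swapAt (suc i) zero          = zero
swapAt (suc i) (suc k)       = suc (swapAt i k)

swapAt-involutive : ∀ {n} (i : Fin n) k → swapAt i (swapAt i k) ≡ k
swapAt-involutive zero    zero          = refl
swapAt-involutive zero    (suc zero)    = refl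
swapAt-involutive zero    (suc (suc k)) = refl
swapAt-involutive (suc i) zero          = refl
swapAt-involutive (suc i) (suc k)       = cong suc (swapAt-involutive i k)

swapAt-inject₁ : ∀ {n} (i : Fin n) → swapAt i (inject₁ i) ≡ suc i
swapAt-inject₁ zero    = refl
swapAt-inject₁ (suc i) = cong suc (swapAt-inject₁ i)

swapAt-above : ∀ {n} (i : Fin n) k → suc i < k → swapAt i k ≡ k
swapAt-above zero    (suc (suc k)) i<k       = refl
swapAt-above zero    (suc zero)    (s≤s ())
swapAt-above (suc i) (suc k)       (s≤s i<k) = cong suc (swapAt-above i k i<k)

swapAt-permutation : ∀ {n} → Fin n → Permutation (suc n) (suc n)
swapAt-permutation i = permutation (swapAt i) (swapAt i) (swapAt-involutive i) (swapAt-involutive i)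

sgn : ∀ {n} → Fin n → ℤ
sgn j = -1ℤ ℤ.^ toℕ j

-- Either l is one of the two swapped columns, and deleting l or its partner leaves the same minor,
-- or the minor inherits an adjacent swap.
swapAt-punchIn : ∀ {n} (i : Fin (suc n)) (l : Fin (suc (suc n))) →
  (sgn (swapAt i l) ≡ - sgn l × (∀ k → swapAt i (punchIn l k) ≡ punchIn (swapAt i l) k)) ⊎
  (swapAt i l ≡ l × ∃ λ i′ → ∀ k → swapAt i (punchIn l k) ≡ punchIn l (swapAt i′ k))
swapAt-punchIn zero zero = inj₁ (refl , λ { zero → refl ; (suc k) → refl })
swapAt-punchIn zero (suc zero) = inj₁ (refl , λ { zero → refl ; (suc k) → refl })
swapAt-punchIn {suc n} zero (suc (suc l)) =
  inj₂ (refl , zero , λ { zero → refl ; (suc zero) → refl ; (suc (suc k)) → refl })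
swapAt-punchIn {suc n} (suc i) zero = inj₂ (refl , i , λ k → refl)
swapAt-punchIn {suc n} (suc i) (suc l) with swapAt-punchIn i l
... | inj₁ (sgn-flips , commutes) =
  inj₁ (trans (cong (-1ℤ *_) sgn-flips) (sym (ℤ.neg-distribʳ-* -1ℤ (sgn l)))
       , λ { zero → refl ; (suc k) → cong suc (commutes k) })
... | inj₂ (fixed , i′ , commutes) =
  inj₂ (cong suc fixed , suc i′ , λ { zero → refl ; (suc k) → cong suc (commutes k) })

-- Induction through the first-row expansion. By `swapAt-punchIn` the term at `l` is minus the term
-- of `det M` at `σ l`: either the sign flips and the minor is the same, or the sign is the same and
-- the minor is negated by induction. Summing over `σ l` instead of `l` only reorders the terms.
det-swapAt : ∀ {n} (i : Fin n) (M : Matrix (suc n) (suc n)) →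
             det (λ r k → M r (swapAt i k)) ≡ - det M
det-swapAt {suc n} i M = begin
  sum (λ l → sgn l * M zero (σ l) * det (λ r k → M (suc r) (σ (punchIn l k))))
    ≡⟨ sum-cong-≗ term ⟩
  sum (λ l → -1ℤ * (expansion (σ l)))
    ≡⟨ *-distribˡ-sum -1ℤ (expansion ∘ σ) ⟨
  -1ℤ * sum (expansion ∘ σ)
    ≡⟨ cong (-1ℤ *_) (sum-permute expansion (swapAt-permutation i)) ⟨
  -1ℤ * det M
    ≡⟨ ℤ.-1*i≡-i (det M) ⟩
  - det M ∎
  where
  open ≡-Reasoning
  σ = swapAt i
  expansion : Fin (suc (suc n)) → ℤ
  expansion l = sgn l * M zero l * det (λ r k → M (suc r) (punchIn l k))
  negate-sign : ∀ s a d → s * a * d ≡ -1ℤ * ((- s) * a * d)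
  negate-sign = solve-∀
  negate-det : ∀ s a d → s * a * (- d) ≡ -1ℤ * (s * a * d)
  negate-det = solve-∀
  term : ∀ l → sgn l * M zero (σ l) * det (λ r k → M (suc r) (σ (punchIn l k))) ≡ -1ℤ * expansion (σ l)
  term l with swapAt-punchIn i l
  ... | inj₁ (sgn-flips , commutes) = begin
    sgn l * M zero (σ l) * det (λ r k → M (suc r) (σ (punchIn l k)))
      ≡⟨ cong (sgn l * M zero (σ l) *_) (det-cong λ r k → cong (M (suc r)) (commutes k)) ⟩
    sgn l * M zero (σ l) * minor
      ≡⟨ negate-sign (sgn l) (M zero (σ l)) minor ⟩
    -1ℤ * ((- sgn l) * M zero (σ l) * minor)
      ≡⟨ cong (λ s → -1ℤ * (s * M zero (σ l) * minor)) sgn-flips ⟨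
    -1ℤ * expansion (σ l) ∎
    where minor = det (λ r k → M (suc r) (punchIn (σ l) k))
  ... | inj₂ (fixed , i′ , commutes) rewrite fixed = begin
    sgn l * M zero l * det (λ r k → M (suc r) (σ (punchIn l k)))
      ≡⟨ cong (sgn l * M zero l *_) (trans (det-cong λ r k → cong (M (suc r)) (commutes k))
                                           (det-swapAt i′ (λ r k → M (suc r) (punchIn l k)))) ⟩
    sgn l * M zero l * - det (λ r k → M (suc r) (punchIn l k))
      ≡⟨ negate-det (sgn l) (M zero l) _ ⟩
    -1ℤ * expansion l ∎

EqualColumnsKill : ∀ {n} → Fin n → Fin n → Set
EqualColumnsKill {n} j k = ∀ (M : Matrix n n) → (∀ i → M i j ≡ M i k) → det M ≡ 0ℤ

-- In the matrix with swapped columns the equal columns sit at `j` and `k`, and its determinant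
-- differs from `det M` only in sign.
equalColumnsKill-swapAt : ∀ {n} (i : Fin n) {j k j′ k′} → swapAt i j ≡ j′ → swapAt i k ≡ k′ →
                          EqualColumnsKill j k → EqualColumnsKill j′ k′
equalColumnsKill-swapAt i {j} {k} refl refl kill M eq = begin
  det M                          ≡⟨ ℤ.neg-involutive (det M) ⟨
  - - det M                      ≡⟨ cong -_ (det-swapAt i M) ⟨
  - det (λ r l → M r (swapAt i l)) ≡⟨ cong -_ (kill _ eq) ⟩
  0ℤ                             ∎
  where open ≡-Reasoning

i≡-i⇒i≡0 : ∀ i → i ≡ - i → i ≡ 0ℤ
i≡-i⇒i≡0 (+ zero) _ = refl

-- Swapping the two equal columns returns `M` but negates the determinant, and only 0 equals its own
-- negative.
equalColumns₀₁ : ∀ {n} → EqualColumnsKill {suc (suc n)} zero (suc zero)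
equalColumns₀₁ M eq = i≡-i⇒i≡0 (det M) (trans (det-cong swapped) (det-swapAt zero M))
  where
  swapped : ∀ i k → M i k ≡ M i (swapAt zero k)
  swapped i zero          = eq i
  swapped i (suc zero)    = sym (eq i)
  swapped i (suc (suc k)) = refl

-- Starting from columns 0 and 1, the second column moves right one adjacent swap at a time;
-- `swapAt (suc i)` fixes column 0.
equalColumns₀ : ∀ {n} (k : Fin n) → EqualColumnsKill zero (suc k)
equalColumns₀ {suc n} = <-weakInduction (λ k → EqualColumnsKill zero (suc k)) equalColumns₀₁
  λ i → equalColumnsKill-swapAt (suc i) refl (swapAt-inject₁ (suc i))

-- Now the first column moves right: `swapAt i` takes `inject₁ i` to `suc i` and fixes every `k`
-- beyond it.
equalColumns-< : ∀ {n} (j k : Fin n) → j < k → EqualColumnsKill j k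
equalColumns-< {suc n} = <-weakInduction (λ j → ∀ k → j < k → EqualColumnsKill j k)
  (λ { (suc k) _ → equalColumns₀ k })
  λ i kill k i<k → equalColumnsKill-swapAt i (swapAt-inject₁ i) (swapAt-above i k i<k)
                     (kill k (ℕ.<-trans (s≤s (ℕ.≤-reflexive (Fin.toℕ-inject₁ i))) i<k))

equalColumns : ∀ {n} (j k : Fin n) → j ≢ k → EqualColumnsKill j k
equalColumns j k j≢k with <-cmp j k
... | tri< j<k _ _ = equalColumns-< j k j<k
... | tri≈ _ j≡k _ = contradiction j≡k j≢k
... | tri> _ _ k<j = λ M eq → equalColumns-< k j k<j M (sym ∘ eq)

-- Cofactors of a column, and halving a column.

AgreeOffColumn : ∀ {m n} → Fin n → Matrix m n → Matrix m n → Set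
AgreeOffColumn j M M′ = ∀ i k → k ≢ j → M′ i k ≡ M i k

-- Expansion along column `j`, derived from the first-row definition by induction on the size. The
-- cofactors are chosen before `M′` is given, so one vector `c` serves every matrix that differs
-- from `M` only in column `j`; this makes the determinant linear in that column.
columnCofactors : ∀ {n} (j : Fin n) (M : Matrix n n) →
  ∃ λ (c : Vector ℤ n) → ∀ M′ → AgreeOffColumn j M M′ → det M′ ≡ ∑[ i < n ] (M′ i j * c i)
columnCofactors {suc n} j M = c , expand
  where
  open ≡-Reasoning
  column : Fin n → Fin (suc n)
  column = punchIn j
  -- The position that column `j` takes in the minor once `column l` is deleted.
  j↓ : Fin n → Fin n
  j↓ l = punchOut (punchInᵢ≢i j l)
  column-j↓ : ∀ l → punchIn (column l) (j↓ l) ≡ j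
  column-j↓ l = punchIn-punchOut (punchInᵢ≢i j l)
  minor : Matrix (suc n) (suc n) → Fin (suc n) → Matrix n n
  minor M l i = removeAt (M (suc i)) l
  cofactors = λ l → columnCofactors (j↓ l) (minor M (column l))
  weight : Fin n → ℤ
  weight l = sgn (column l) * M zero (column l)
  -- Row 0 contributes the term at `j` itself; every other term of the first-row expansion reaches
  -- column `j` through its minor, and these contributions are gathered by row.
  c : Fin (suc n) → ℤ
  c zero    = sgn j * det (minor M j)
  c (suc i) = ∑[ l < n ] (weight l * proj₁ (cofactors l) i)
  pull : ∀ w m d → w * (m * d) ≡ m * (w * d)
  pull = solve-∀
  front : ∀ s a d → s * a * d ≡ a * (s * d)
  front = solve-∀
  expand : ∀ M′ → AgreeOffColumn j M M′ → det M′ ≡ ∑[ i < suc n ] (M′ i j * c i)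
  expand M′ agree = begin
    det M′
      ≡⟨ sum-remove {i = j} term ⟩
    term j + ∑[ l < n ] term (column l)
      ≡⟨ cong₂ _+_ (trans (front (sgn j) (M′ zero j) _)
                          (cong (λ d → M′ zero j * (sgn j * d)) (det-cong λ i k → agree (suc i) _ (punchInᵢ≢i j k))))
                   (sum-cong-≗ λ l → cong₂ _*_ (cong (sgn (column l) *_) (agree zero (column l) (punchInᵢ≢i j l)))
                                               (expand-minor l)) ⟩
    M′ zero j * c zero + ∑[ l < n ] (weight l * ∑[ i < n ] (M′ (suc i) j * proj₁ (cofactors l) i))
      ≡⟨ cong (_+_ (M′ zero j * c zero)) exchange ⟩
    M′ zero j * c zero + ∑[ i < n ] (M′ (suc i) j * c (suc i)) ∎
    where
    term : Fin (suc n) → ℤ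
    term l = sgn l * M′ zero l * det (minor M′ l)
    exchange : ∑[ l < n ] (weight l * ∑[ i < n ] (M′ (suc i) j * proj₁ (cofactors l) i)) ≡
               ∑[ i < n ] (M′ (suc i) j * c (suc i))
    exchange = begin
      ∑[ l < n ] (weight l * ∑[ i < n ] (M′ (suc i) j * proj₁ (cofactors l) i))
        ≡⟨ sum-cong-≗ (λ l → *-distribˡ-sum (weight l) λ i → M′ (suc i) j * proj₁ (cofactors l) i) ⟩
      ∑[ l < n ] ∑[ i < n ] (weight l * (M′ (suc i) j * proj₁ (cofactors l) i))
        ≡⟨ ∑-comm (λ l i → weight l * (M′ (suc i) j * proj₁ (cofactors l) i)) ⟩
      ∑[ i < n ] ∑[ l < n ] (weight l * (M′ (suc i) j * proj₁ (cofactors l) i))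
        ≡⟨ sum-cong-≗ (λ i → trans (sum-cong-≗ λ l → pull (weight l) (M′ (suc i) j) (proj₁ (cofactors l) i))
                                   (sym (*-distribˡ-sum (M′ (suc i) j) λ l → weight l * proj₁ (cofactors l) i))) ⟩
      ∑[ i < n ] (M′ (suc i) j * c (suc i)) ∎
    -- `punchIn` is injective, so a column of the minor other than `j↓ l` comes from a column of
    -- `M′` other than `j`, where `M′` agrees with `M`.
    expand-minor : ∀ l → det (minor M′ (column l)) ≡ ∑[ i < n ] (M′ (suc i) j * proj₁ (cofactors l) i)
    expand-minor l = trans
      (proj₂ (cofactors l) (minor M′ (column l)) λ i k k≢j↓ → agree (suc i) (punchIn (column l) k)
        λ eq → k≢j↓ (punchIn-injective (column l) k (j↓ l) (trans eq (sym (column-j↓ l)))))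
      (sum-cong-≗ λ i → cong (λ k → M′ (suc i) k * proj₁ (cofactors l) i) (column-j↓ l))

setColumn : ∀ {m n} → Matrix m n → Fin n → Vector ℤ m → Matrix m n
setColumn M j w i = updateAt (M i) j (const (w i))

sum-single : ∀ {n} (j : Fin n) (f : Vector ℤ n) → (∀ k → k ≢ j → f k ≡ 0ℤ) → sum f ≡ f j
sum-single {suc n} j f zeros = begin
  sum f                     ≡⟨ sum-remove {i = j} f ⟩
  f j + sum (removeAt f j)  ≡⟨ cong (_+_ (f j)) (sum-cong-≗ λ k → zeros (punchIn j k) (punchInᵢ≢i j k)) ⟩
  f j + sum {n} (λ _ → 0ℤ)  ≡⟨ cong (_+_ (f j)) (sum-replicate-zero n) ⟩
  f j + 0ℤ                  ≡⟨ ℤ.+-identityʳ (f j) ⟩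
  f j                       ∎
  where open ≡-Reasoning

-- With `c` the cofactors of column `j`, the sum over `k` of `a k * ∑[ i < n ] (M i k * c i)`
-- reduces to its term at `j`, which is `det M`. Exchanging the two sums turns it into the expansion
-- of a determinant whose column `j` has the entries `w i * + 2`.
det-halveColumn : ∀ {n} (M : Matrix n n) (j : Fin n) (a w : Vector ℤ n) → a j ≡ 1ℤ →
  (∀ i → ∑[ k < n ] (a k * M i k) ≡ w i * + 2) → det M ≡ det (setColumn M j w) * + 2
det-halveColumn {n} M j a w aⱼ≡1 halves = begin
  det M
    ≡⟨ ℤ.*-identityˡ (det M) ⟨
  1ℤ * det M
    ≡⟨ cong₂ _*_ (sym aⱼ≡1) (det-by-cofactors M λ _ _ _ → refl) ⟩
  a j * ∑[ i < n ] (M i j * c i)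
    ≡⟨ sum-single j (λ k → a k * ∑[ i < n ] (M i k * c i))
         (λ k k≢j → trans (cong (a k *_) (off-diagonal k k≢j)) (ℤ.*-zeroʳ (a k))) ⟨
  ∑[ k < n ] (a k * ∑[ i < n ] (M i k * c i))
    ≡⟨ sum-cong-≗ (λ k → *-distribˡ-sum (a k) λ i → M i k * c i) ⟩
  ∑[ k < n ] ∑[ i < n ] (a k * (M i k * c i))
    ≡⟨ ∑-comm (λ k i → a k * (M i k * c i)) ⟩
  ∑[ i < n ] ∑[ k < n ] (a k * (M i k * c i))
    ≡⟨ sum-cong-≗ (λ i → trans (sum-cong-≗ λ k → sym (ℤ.*-assoc (a k) (M i k) (c i)))
                                 (sym (*-distribʳ-sum (c i) λ k → a k * M i k))) ⟩
  ∑[ i < n ] (∑[ k < n ] (a k * M i k) * c i)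
    ≡⟨ sum-cong-≗ (λ i → trans (cong (_* c i) (halves i)) (rotate (w i) (c i))) ⟩
  ∑[ i < n ] (w i * c i * + 2)
    ≡⟨ *-distribʳ-sum (+ 2) (λ i → w i * c i) ⟨
  ∑[ i < n ] (w i * c i) * + 2
    ≡⟨ cong (_* + 2) (det-setColumn w) ⟨
  det (setColumn M j w) * + 2 ∎
  where
  open ≡-Reasoning
  c = proj₁ (columnCofactors j M)
  det-by-cofactors = proj₂ (columnCofactors j M)
  rotate : ∀ w c → w * + 2 * c ≡ w * c * + 2
  rotate = solve-∀
  setColumn-agrees : ∀ v → AgreeOffColumn j M (setColumn M j v)
  setColumn-agrees v i k k≢j = updateAt-minimal k j (M i) k≢j
  det-setColumn : ∀ v → det (setColumn M j v) ≡ ∑[ i < n ] (v i * c i)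
  det-setColumn v = trans (det-by-cofactors _ (setColumn-agrees v))
    (sum-cong-≗ λ i → cong (_* c i) (updateAt-updates j (M i)))
  -- This sum is the determinant of `M` with column `k` copied over column `j`, so two columns
  -- coincide.
  off-diagonal : ∀ k → k ≢ j → ∑[ i < n ] (M i k * c i) ≡ 0ℤ
  off-diagonal k k≢j = trans (sym (det-setColumn λ i → M i k))
    (equalColumns j k (k≢j ∘ sym) _ λ i →
      trans (updateAt-updates j (M i)) (sym (setColumn-agrees (λ i → M i k) i k k≢j)))

-- Kernels mod 2 of integer matrices.

module F₂ where
  open CommutativeRing Bool.xor-∧-commutativeRing public using (semiring)
  open import Algebra.Properties.Semiring.Sum semiring public

⟦_⟧ : Bool → ℤ
⟦ b ⟧ = if b then 1ℤ else 0ℤ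

-- Stated by divisibility in the integers because the quotients become the entries of the halved
-- column in `2^n∣det`.
EvenKernel : ∀ {m n} → Matrix m n → Vector Bool n → Set
EvenKernel {n = n} M c = ∀ i → + 2 ℤ.∣ ∑[ k < n ] (⟦ c k ⟧ * M i k)

⟦xor⟧ : ∀ a b → ⟦ a xor b ⟧ ≡ ⟦ a ⟧ + ⟦ b ⟧ + + 2 * (- (⟦ a ⟧ * ⟦ b ⟧))
⟦xor⟧ false false = refl
⟦xor⟧ false true  = refl
⟦xor⟧ true  false = refl
⟦xor⟧ true  true  = refl

evenKernel-cong : ∀ {m n} {M : Matrix m n} {c d : Vector Bool n} → (∀ k → c k ≡ d k) →
                  EvenKernel M c → EvenKernel M d
evenKernel-cong {M = M} c≗d Mc i = subst (+ 2 ℤ.∣_) (sum-cong-≗ λ k → cong (λ b → ⟦ b ⟧ * M i k) (c≗d k)) (Mc i)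

-- `⟦xor⟧` writes the lift of a sum mod 2 as the sum of the lifts plus an explicit multiple of 2, so
-- the row sums add up to within twice `rest`.
evenKernel-xor : ∀ {m n} (M : Matrix m n) {c d : Vector Bool n} →
                 EvenKernel M c → EvenKernel M d → EvenKernel M (λ k → c k xor d k)
evenKernel-xor {n = n} M {c} {d} Mc Md i = subst (+ 2 ℤ.∣_) (sym split)
  (ℤ.∣m∣n⇒∣m+n (ℤ.∣m∣n⇒∣m+n (Mc i) (Md i)) (ℤ.∣m⇒∣m*n rest ℤ.∣-refl))
  where
  open ≡-Reasoning
  rest = ∑[ k < n ] (- (⟦ c k ⟧ * ⟦ d k ⟧) * M i k)
  distribute : ∀ x y z m → (x + y + + 2 * z) * m ≡ x * m + y * m + + 2 * (z * m)
  distribute = solve-∀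
  split : ∑[ k < n ] (⟦ c k xor d k ⟧ * M i k) ≡
          ∑[ k < n ] (⟦ c k ⟧ * M i k) + ∑[ k < n ] (⟦ d k ⟧ * M i k) + + 2 * rest
  split = begin
    ∑[ k < n ] (⟦ c k xor d k ⟧ * M i k)
      ≡⟨ sum-cong-≗ (λ k → trans (cong (_* M i k) (⟦xor⟧ (c k) (d k))) (distribute ⟦ c k ⟧ ⟦ d k ⟧ _ (M i k))) ⟩
    ∑[ k < n ] (⟦ c k ⟧ * M i k + ⟦ d k ⟧ * M i k + + 2 * (- (⟦ c k ⟧ * ⟦ d k ⟧) * M i k))
      ≡⟨ ∑-distrib-+ (λ k → ⟦ c k ⟧ * M i k + ⟦ d k ⟧ * M i k) _ ⟩
    ∑[ k < n ] (⟦ c k ⟧ * M i k + ⟦ d k ⟧ * M i k) + ∑[ k < n ] (+ 2 * (- (⟦ c k ⟧ * ⟦ d k ⟧) * M i k))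
      ≡⟨ cong₂ _+_ (∑-distrib-+ (λ k → ⟦ c k ⟧ * M i k) _)
                   (sym (*-distribˡ-sum (+ 2) λ k → - (⟦ c k ⟧ * ⟦ d k ⟧) * M i k)) ⟩
    ∑[ k < n ] (⟦ c k ⟧ * M i k) + ∑[ k < n ] (⟦ d k ⟧ * M i k) + + 2 * rest ∎

evenKernel-setColumn : ∀ {m n} (M : Matrix m n) {j : Fin n} (w : Vector ℤ m) {c : Vector Bool n} → c j ≡ false →
                       EvenKernel M c → EvenKernel (setColumn M j w) c
evenKernel-setColumn M {j} w {c} cⱼ≡false Mc i = subst (+ 2 ℤ.∣_) (sum-cong-≗ unchanged) (Mc i)
  where
  unchanged : ∀ k → ⟦ c k ⟧ * M i k ≡ ⟦ c k ⟧ * setColumn M j w i k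
  unchanged k with k ≟ j
  ... | yes refl rewrite cⱼ≡false = refl
  ... | no k≢j = cong (⟦ c k ⟧ *_) (sym (updateAt-minimal k j (M i) k≢j))

-- Linear independence mod 2 and elimination.

-- Vectors are kept as functions on `Fin m`, so that they can be changed entry by entry, restricted
-- to the black vertices, or reindexed along a `cast`.
Independent : ∀ {n m} → (Fin n → Vector Bool m) → Set
Independent {n} C = ∀ (ε : Vector Bool n) → (∀ k → F₂.sum (λ a → ε a ∧ C a k) ≡ false) → ∀ a → ε a ≡ false

-- If `C zero` were zero, the coefficients 1, 0, ..., 0 would give a nontrivial relation.
independent-head : ∀ {n m} (C : Fin (suc n) → Vector Bool m) → Independent C → ∃ λ j → C zero j ≡ true
independent-head {n} C ind =
  let j , C₀ⱼ≢false = ¬∀⟶∃¬ _ (λ k → C zero k ≡ false) (λ k → C zero k Bool.≟ false) ¬allFalse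
  in j , Bool.¬-not C₀ⱼ≢false
  where
  ε : Fin (suc n) → Bool
  ε zero    = true
  ε (suc _) = false
  ¬allFalse : ¬ (∀ k → C zero k ≡ false)
  ¬allFalse allFalse =
    contradiction (ind ε (λ k → cong₂ _xor_ (allFalse k) (F₂.sum-replicate-zero n)) zero) λ ()

-- A step of Gaussian elimination with pivot row `C zero`; when `C zero j` is `true` it clears
-- position `j`.
eliminate : ∀ {n m} → (Fin (suc n) → Vector Bool m) → Fin m → Fin n → Vector Bool m
eliminate C j a k = C (suc a) k xor (C (suc a) j ∧ C zero k)

-- A relation `ε` among the eliminated vectors unfolds to one among the original vectors, in which
-- `C zero` receives the coefficient `s`, the total of the multiples added.
independent-eliminate : ∀ {n m} (C : Fin (suc n) → Vector Bool m) (j : Fin m) →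
                        Independent C → Independent (eliminate C j)
independent-eliminate {n} C j ind ε vanishes a = ind ε⁺ vanishes⁺ (suc a)
  where
  open ≡-Reasoning
  s = F₂.sum (λ a → ε a ∧ C (suc a) j)
  ε⁺ : Fin (suc n) → Bool
  ε⁺ zero    = s
  ε⁺ (suc a) = ε a
  vanishes⁺ : ∀ k → F₂.sum (λ a → ε⁺ a ∧ C a k) ≡ false
  vanishes⁺ k = begin
    (s ∧ C zero k) xor F₂.sum (λ a → ε a ∧ C (suc a) k)
      ≡⟨ Bool.xor-comm (s ∧ C zero k) _ ⟩
    F₂.sum (λ a → ε a ∧ C (suc a) k) xor (s ∧ C zero k)
      ≡⟨ cong (F₂.sum (λ a → ε a ∧ C (suc a) k) xor_) (F₂.*-distribʳ-sum (C zero k) λ a → ε a ∧ C (suc a) j) ⟩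
    F₂.sum (λ a → ε a ∧ C (suc a) k) xor F₂.sum (λ a → (ε a ∧ C (suc a) j) ∧ C zero k)
      ≡⟨ F₂.∑-distrib-+ (λ a → ε a ∧ C (suc a) k) _ ⟨
    F₂.sum (λ a → (ε a ∧ C (suc a) k) xor ((ε a ∧ C (suc a) j) ∧ C zero k))
      ≡⟨ F₂.sum-cong-≗ (λ a → trans (cong ((ε a ∧ C (suc a) k) xor_) (Bool.∧-assoc (ε a) _ _))
                                        (sym (Bool.∧-distribˡ-xor (ε a) _ _))) ⟩
    F₂.sum (λ a → ε a ∧ eliminate C j a k)
      ≡⟨ vanishes k ⟩
    false ∎

-- The induction is on the number of vectors, over all matrices of the fixed size `m`, since each
-- step passes to the matrix with a halved column.
2^n∣det : ∀ {n m} (M : Matrix m m) (C : Fin n → Vector Bool m) → Independent C →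
          (∀ a → EvenKernel M (C a)) → + (2 ^ n) ℤ.∣ det M
2^n∣det {zero}  M C ind MC = ℤ.divides (det M) (sym (ℤ.*-identityʳ (det M)))
2^n∣det {suc n} {m} M C ind MC with independent-head C ind
... | j , C₀ⱼ≡true with 2^n∣det (setColumn M j w) (eliminate C j) (independent-eliminate C j ind) kernel
  where
  w : Vector ℤ m
  w i = ℤ._∣_.quotient (MC zero i)
  cleared : ∀ a → eliminate C j a j ≡ false
  cleared a rewrite C₀ⱼ≡true | Bool.∧-identityʳ (C (suc a) j) = Bool.xor-same (C (suc a) j)
  -- Depending on its entry at `j`, the eliminated vector is `C (suc a)` with `C zero` added, or
  -- `C (suc a)` itself.
  reduced : ∀ a → EvenKernel M (eliminate C j a)
  reduced a with C (suc a) j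
  ... | true  = evenKernel-xor M {C (suc a)} {C zero} (MC (suc a)) (MC zero)
  ... | false = evenKernel-cong {M = M} (λ k → sym (Bool.xor-identityʳ (C (suc a) k))) (MC (suc a))
  kernel : ∀ a → EvenKernel (setColumn M j w) (eliminate C j a)
  kernel a = evenKernel-setColumn M w {eliminate C j a} (cleared a) (reduced a)
... | ℤ.divides q det≡q*2^n = ℤ.divides q (begin
  det M
    ≡⟨ det-halveColumn M j (λ k → ⟦ C zero k ⟧) _ (cong ⟦_⟧ C₀ⱼ≡true) (λ i → ℤ._∣_.equality (MC zero i)) ⟩
  det (setColumn M j _) * + 2 ≡⟨ cong (_* + 2) det≡q*2^n ⟩
  q * + (2 ^ n) * + 2         ≡⟨ ℤ.*-assoc q (+ (2 ^ n)) (+ 2) ⟩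
  q * (+ (2 ^ n) * + 2)       ≡⟨ cong (q *_) (trans (ℤ.*-comm (+ (2 ^ n)) (+ 2)) (sym (ℤ.pos-* 2 (2 ^ n)))) ⟩
  q * + (2 ^ suc n)           ∎)
  where open ≡-Reasoning

-- Subsets as vectors mod 2, and channels as kernel vectors of the adjacency matrix and its
-- signings.

lookup-combination : ∀ {n k} (ε : Vector Bool n) (C : Vector (Subset k) n) v →
                     lookup (combination ε C) v ≡ F₂.sum (λ a → ε a ∧ lookup (C a) v)
lookup-combination {zero}  ε C v = lookup-replicate v false
lookup-combination {suc n} ε C v =
  trans (lookup-zipWith _xor_ v (if ε zero then C zero else Subset.⊥) _)
        (cong₂ _xor_ (lookup-scale (ε zero)) (lookup-combination (ε ∘ suc) (C ∘ suc) v))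
  where
  lookup-scale : ∀ b → lookup (if b then C zero else Subset.⊥) v ≡ b ∧ lookup (C zero) v
  lookup-scale true  = refl
  lookup-scale false = lookup-replicate v false

lookup-extensional : ∀ {A : Set} {n} {xs ys : Vec.Vec A n} → (∀ i → lookup xs i ≡ lookup ys i) → xs ≡ ys
lookup-extensional {xs = xs} {ys} eq =
  trans (sym (tabulate∘lookup xs)) (trans (tabulate-cong eq) (tabulate∘lookup ys))

linearlyIndependent⇒independent : ∀ {n k} (C : Vector (Subset k) n) →
                                  LinearlyIndependent C → Independent (λ a → lookup (C a))
linearlyIndependent⇒independent C ind ε vanishes = ind ε (lookup-extensional λ v →
  trans (lookup-combination ε C v) (trans (vanishes v) (sym (lookup-replicate v false))))

-- For `f` a row of the adjacency relation the right side is a row sum as in `EvenKernel`. The same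
-- count serves later with `f` the incidence of a vertex with the edges.
∣tabulate∩∣ : ∀ {n} (f : Fin n → Bool) (p : Subset n) →
              + ∣ tabulate f ∩ p ∣ ≡ ∑[ k < n ] (⟦ lookup p k ⟧ * ⟦ f k ⟧)
∣tabulate∩∣ f []      = refl
∣tabulate∩∣ f (x ∷ p) with f zero | x | ∣tabulate∩∣ (f ∘ suc) p
... | true  | true  | ih = cong (_+_ 1ℤ) ih
... | true  | false | ih = trans ih (sym (ℤ.+-identityˡ _))
... | false | true  | ih = trans ih (sym (ℤ.+-identityˡ _))
... | false | false | ih = trans ih (sym (ℤ.+-identityˡ _))

module _ {N : ℕ} (G : Graph N) where

  isChannel⇒evenKernel : ∀ {C} → IsChannel G C → EvenKernel (adjacency G) (lookup C)
  isChannel⇒evenKernel {C} even v =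
    subst (+ 2 ℤ.∣_) (∣tabulate∩∣ (Graph.adj G v) C) (ℤ.∣ᵤ⇒∣ (even v))

  evenKernel⇒isChannel : ∀ {C} → EvenKernel (adjacency G) (lookup C) → IsChannel G C
  evenKernel⇒isChannel {C} even v =
    ℤ.∣⇒∣ᵤ (subst (+ 2 ℤ.∣_) (sym (∣tabulate∩∣ (Graph.adj G v) C)) (even v))

  -- Together with `isChannel-⊥` this makes the channels a subspace, as `subspaceBasis` requires.
  isChannel-△ : ∀ {C D} → IsChannel G C → IsChannel G D → IsChannel G (C △ D)
  isChannel-△ {C} {D} chC chD = evenKernel⇒isChannel
    (evenKernel-cong {M = adjacency G} (λ v → sym (lookup-zipWith _xor_ v C D))
      (evenKernel-xor (adjacency G) {lookup C} {lookup D} (isChannel⇒evenKernel chC) (isChannel⇒evenKernel chD)))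

  isChannel-⊥ : IsChannel G Subset.⊥
  isChannel-⊥ = evenKernel⇒isChannel λ i → subst (+ 2 ℤ.∣_) (sym (trans
    (sum-cong-≗ λ v → cong (λ b → ⟦ b ⟧ * adjacency G i v) (lookup-replicate v false)) (sum-replicate-zero N)))
    (ℤ.divides 0ℤ refl)

∣-sum : ∀ {d n} (f : Vector ℤ n) → (∀ k → d ℤ.∣ f k) → d ℤ.∣ sum f
∣-sum {n = zero}  f d∣f = ℤ.divides 0ℤ refl
∣-sum {n = suc n} f d∣f = ℤ.∣m∣n⇒∣m+n (d∣f zero) (∣-sum (f ∘ suc) (d∣f ∘ suc))

-- Changing the sign of an entry changes it by an even number, so the row sums for `K` and `A` have
-- the same parity.
evenKernel-signing : ∀ {m n} {A K : Matrix m n} {c : Vector Bool n} → IsSigningOf A K →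
                     EvenKernel A c → EvenKernel K c
evenKernel-signing {n = n} {A} {K} {c} signing Ac i = subst (+ 2 ℤ.∣_)
  (trans (sym (∑-distrib-+ (λ k → ⟦ c k ⟧ * A i k) (λ k → ⟦ c k ⟧ * (K i k - A i k))))
         (sum-cong-≗ λ k → recombine ⟦ c k ⟧ (A i k) (K i k)))
  (ℤ.∣m∣n⇒∣m+n (Ac i) (∣-sum (λ k → ⟦ c k ⟧ * (K i k - A i k)) λ k → ℤ.∣n⇒∣m*n ⟦ c k ⟧ (even-difference k)))
  where
  recombine : ∀ c a k → c * a + c * (k - a) ≡ c * k
  recombine = solve-∀
  double : ∀ a → - a - a ≡ - a * + 2
  double = solve-∀
  even-difference : ∀ k → + 2 ℤ.∣ K i k - A i k
  even-difference k with signing i k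
  ... | inj₁ K≡A  = ℤ.divides 0ℤ (ℤ.i≡j⇒i-j≡0 K≡A)
  ... | inj₂ K≡-A = ℤ.divides (- A i k) (trans (cong (_- A i k) K≡-A) (double (A i k)))

-- Counting subsets, and bases of subspaces mod 2.

module _ {A B : Set} {P : Pred B 0ℓ} (P? : Decidable P) (f : A → B) where

  length-filter-map : ∀ xs → length (filter P? (map f xs)) ≡ length (filter (P? ∘ f) xs)
  length-filter-map []       = refl
  length-filter-map (x ∷ xs) with does (P? (f x))
  ... | true  = cong suc (length-filter-map xs)
  ... | false = length-filter-map xs

#subsets-suc : ∀ {n} {P : Pred (Subset (suc n)) 0ℓ} (P? : Decidable P) →
               #subsets P? ≡ #subsets (P? ∘ (outside ∷_)) ℕ.+ #subsets (P? ∘ (inside ∷_))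
#subsets-suc {n} P? = trans
  (cong length (filter-++ P? (map (outside ∷_) (subsets n)) (map (inside ∷_) (subsets n))))
  (trans (length-++ (filter P? (map (outside ∷_) (subsets n))))
         (cong₂ ℕ._+_ (length-filter-map P? (outside ∷_) (subsets n)) (length-filter-map P? (inside ∷_) (subsets n))))

#subsets-cong : ∀ {n} {P Q : Pred (Subset n) 0ℓ} (P? : Decidable P) (Q? : Decidable Q) →
                P ≐ Q → #subsets P? ≡ #subsets Q?
#subsets-cong P? Q? P≐Q = cong length (filter-≐ P? Q? P≐Q (subsets _))

#subsets-none : ∀ {n} {P : Pred (Subset n) 0ℓ} (P? : Decidable P) → (∀ x → ¬ P x) → #subsets P? ≡ 0
#subsets-none P? ¬P = cong length (filter-none P? (All.universal ¬P (subsets _)))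

-- Translation by `x` permutes the subsets. In the recursion a head `inside` exchanges the two
-- halves given by `#subsets-suc`, and a head `outside` keeps them in place.
#subsets-△ : ∀ {n} {P : Pred (Subset n) 0ℓ} (P? : Decidable P) x →
             #subsets (λ y → P? (x △ y)) ≡ #subsets P?
#subsets-△ P? []            = #subsets-cong (λ y → P? ([] △ y)) P? ((λ { {[]} p → p }) , λ { {[]} p → p })
#subsets-△ P? (outside ∷ x) = begin
  #subsets (λ y → P? ((outside ∷ x) △ y))
    ≡⟨ #subsets-suc (λ y → P? ((outside ∷ x) △ y)) ⟩
  #subsets (λ y → P? (outside ∷ (x △ y))) ℕ.+ #subsets (λ y → P? (inside ∷ (x △ y)))
    ≡⟨ cong₂ ℕ._+_ (#subsets-△ (P? ∘ (outside ∷_)) x) (#subsets-△ (P? ∘ (inside ∷_)) x) ⟩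
  #subsets (P? ∘ (outside ∷_)) ℕ.+ #subsets (P? ∘ (inside ∷_))
    ≡⟨ #subsets-suc P? ⟨
  #subsets P? ∎
  where open ≡-Reasoning
#subsets-△ P? (inside ∷ x) = begin
  #subsets (λ y → P? ((inside ∷ x) △ y))
    ≡⟨ #subsets-suc (λ y → P? ((inside ∷ x) △ y)) ⟩
  #subsets (λ y → P? (inside ∷ (x △ y))) ℕ.+ #subsets (λ y → P? (outside ∷ (x △ y)))
    ≡⟨ cong₂ ℕ._+_ (#subsets-△ (P? ∘ (inside ∷_)) x) (#subsets-△ (P? ∘ (outside ∷_)) x) ⟩
  #subsets (P? ∘ (inside ∷_)) ℕ.+ #subsets (P? ∘ (outside ∷_))
    ≡⟨ ℕ.+-comm (#subsets (P? ∘ (inside ∷_))) _ ⟩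
  #subsets (P? ∘ (outside ∷_)) ℕ.+ #subsets (P? ∘ (inside ∷_))
    ≡⟨ #subsets-suc P? ⟨
  #subsets P? ∎
  where open ≡-Reasoning

△-self-inverse : ∀ {n} (x y : Subset n) → x △ (x △ y) ≡ y
△-self-inverse []      []      = refl
△-self-inverse (a ∷ x) (b ∷ y) = cong₂ _∷_
  (trans (sym (Bool.xor-assoc a a b)) (cong (_xor b) (Bool.xor-same a))) (△-self-inverse x y)

-- The members with head `outside` form a subspace in dimension `m`, which has a basis by recursion.
-- If some member has head `inside`, all such members form one coset of that subspace, so the count
-- doubles and that member joins the basis.
subspaceBasis : ∀ m {P : Pred (Subset m) 0ℓ} (P? : Decidable P) →
  P Subset.⊥ → (∀ {x y} → P x → P y → P (x △ y)) →
  ∃ λ k → ∃ λ (C : Vector (Subset m) k) →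
    (∀ a → P (C a)) × Independent (λ a → lookup (C a)) × #subsets P? ≡ 2 ^ k
subspaceBasis zero P? P⊥ P△ with P? []
... | yes _  = 0 , (λ ()) , (λ ()) , (λ _ _ ()) , refl
... | no ¬P⊥ = contradiction P⊥ ¬P⊥
subspaceBasis (suc m) {P} P? P⊥ P△
  with subspaceBasis m (P? ∘ (outside ∷_)) P⊥ P△ | anySubset? (P? ∘ (inside ∷_))
... | k , C , PC , ind , count | no none =
  k , (λ a → outside ∷ C a) , PC , (λ ε vanishes → ind ε (vanishes ∘ suc)) , (begin
    #subsets P?
      ≡⟨ #subsets-suc P? ⟩
    #subsets (P? ∘ (outside ∷_)) ℕ.+ #subsets (P? ∘ (inside ∷_))
      ≡⟨ cong₂ ℕ._+_ count (#subsets-none (P? ∘ (inside ∷_)) λ x Px → none (x , Px)) ⟩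
    2 ^ k ℕ.+ 0
      ≡⟨ ℕ.+-identityʳ (2 ^ k) ⟩
    2 ^ k ∎)
  where open ≡-Reasoning
... | k , C , PC , ind , count | yes (x , Px) = suc k , C⁺ , PC⁺ , ind⁺ , (begin
    #subsets P?
      ≡⟨ #subsets-suc P? ⟩
    #subsets (P? ∘ (outside ∷_)) ℕ.+ #subsets (P? ∘ (inside ∷_))
      ≡⟨ cong (#subsets (P? ∘ (outside ∷_)) ℕ.+_)
           -- Adding the member `inside ∷ x` takes `inside ∷ y` to `outside ∷ (x △ y)` and back, so
           -- both satisfy `P` or neither does.
           (trans (#subsets-cong (P? ∘ (inside ∷_)) (λ y → P? (outside ∷ (x △ y)))
                    (P△ Px , λ {y} Pxy → subst (P ∘ (inside ∷_)) (△-self-inverse x y) (P△ Px Pxy)))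
                  (#subsets-△ (P? ∘ (outside ∷_)) x)) ⟩
    #subsets (P? ∘ (outside ∷_)) ℕ.+ #subsets (P? ∘ (outside ∷_))
      ≡⟨ cong₂ ℕ._+_ count (trans count (sym (ℕ.+-identityʳ (2 ^ k)))) ⟩
    2 ^ suc k ∎)
  where
  open ≡-Reasoning
  C⁺ : Vector (Subset (suc m)) (suc k)
  C⁺ zero    = inside ∷ x
  C⁺ (suc a) = outside ∷ C a
  PC⁺ : ∀ a → P (C⁺ a)
  PC⁺ zero    = Px
  PC⁺ (suc a) = PC a
  ind⁺ : Independent (λ a → lookup (C⁺ a))
  ind⁺ ε vanishes = λ { zero → ε₀≡false ; (suc a) → ind (ε ∘ suc) vanishes-tail a }
    where
    -- Only the new vector contains `zero`, so coordinate `zero` of the relation reads off its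
    -- coefficient.
    ε₀≡false : ε zero ≡ false
    ε₀≡false = begin
      ε zero
        ≡⟨ Bool.xor-identityʳ (ε zero) ⟨
      ε zero xor false
        ≡⟨ cong₂ _xor_ (Bool.∧-identityʳ (ε zero))
                       (trans (F₂.sum-cong-≗ λ a → Bool.∧-zeroʳ (ε (suc a))) (F₂.sum-replicate-zero k)) ⟨
      F₂.sum (λ a → ε a ∧ lookup (C⁺ a) zero)
        ≡⟨ vanishes zero ⟩
      false ∎
    vanishes-tail : ∀ v → F₂.sum (λ a → ε (suc a) ∧ lookup (C a) v) ≡ false
    vanishes-tail v = trans
      (cong (λ b → (b ∧ lookup x v) xor F₂.sum (λ a → ε (suc a) ∧ lookup (C a) v)) (sym ε₀≡false))
      (vanishes (suc v))

-- Black channels and colour classes of bipartite graphs.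

-- Turns sums over one colour class into sums over all vertices weighted by an indicator. `g` is
-- general because the recursion passes to `g ∘ suc`; the uses take the identity.
sum-filter-tabulate : ∀ {A : Set} {n} {P : Pred A 0ℓ} (P? : Decidable P) (g : Fin n → A) (f : A → ℤ) →
  sum (λ j → f (List.lookup (filter P? (List.tabulate g)) j)) ≡ ∑[ i < n ] (⟦ does (P? (g i)) ⟧ * f (g i))
sum-filter-tabulate {n = zero}  P? g f = refl
sum-filter-tabulate {n = suc n} P? g f with does (P? (g zero))
... | true  = cong₂ _+_ (sym (ℤ.*-identityˡ (f (g zero)))) (sum-filter-tabulate P? (g ∘ suc) f)
... | false = trans (sum-filter-tabulate P? (g ∘ suc) f) (sym (ℤ.+-identityˡ _))

sum-cast : ∀ {m n} (eq : m ≡ n) (f : Fin n → ℤ) → sum (λ j → f (cast eq j)) ≡ sum f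
sum-cast refl f = sum-cong-≗ λ j → cong f (Fin.cast-is-id refl j)

sum-1 : ∀ n → ∑[ _ < n ] 1ℤ ≡ + n
sum-1 zero    = refl
sum-1 (suc n) = cong (_+_ 1ℤ) (sum-1 n)

sum-unique : ∀ {n} {P Q : Pred (Fin n) 0ℓ} (P? : Decidable P) (Q? : Decidable Q) x → P x → Q x →
             (∀ v → P v → Q v → v ≡ x) → ∑[ v < n ] (⟦ does (P? v) ⟧ * ⟦ does (Q? v) ⟧) ≡ 1ℤ
sum-unique P? Q? x Px Qx unique = trans
  (sum-single x (λ v → ⟦ does (P? v) ⟧ * ⟦ does (Q? v) ⟧) elsewhere)
  (cong₂ (λ a b → ⟦ a ⟧ * ⟦ b ⟧) (dec-true (P? x) Px) (dec-true (Q? x) Qx))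
  where
  elsewhere : ∀ v → v ≢ x → ⟦ does (P? v) ⟧ * ⟦ does (Q? v) ⟧ ≡ 0ℤ
  elsewhere v v≢x with P? v | Q? v
  ... | no _   | _      = refl
  ... | yes _  | no _   = refl
  ... | yes Pv | yes Qv = contradiction (unique v Pv Qv) v≢x

otherColour : {c d : Colour} → c ≢ d → ∀ e → (c ≡ e × d ≢ e) ⊎ (d ≡ e × c ≢ e)
otherColour {black} {black} c≢d e     = contradiction refl c≢d
otherColour {white} {white} c≢d e     = contradiction refl c≢d
otherColour {black} {white} c≢d black = inj₁ (refl , λ ())
otherColour {black} {white} c≢d white = inj₂ (refl , λ ())
otherColour {white} {black} c≢d black = inj₂ (refl , λ ())
otherColour {white} {black} c≢d white = inj₁ (refl , λ ())

module _ {N : ℕ} (G : Graph N) (colour : Fin N → Colour) where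
  open Graph G
  open ≡-Reasoning

  private
    blacks : List (Fin N)
    blacks = verticesOf G colour black

  -- Every vertex of `C` is black, so the row sum over the black columns is the whole row sum of
  -- `adjacency` at the white vertex `w`.
  isBlackChannel⇒evenKernel : ∀ {C} → IsBlackChannel G colour C →
    EvenKernel (bipartiteAdjacency G colour) (λ j → lookup C (List.lookup blacks j))
  isBlackChannel⇒evenKernel {C} (channel , blackOnly) i = subst (+ 2 ℤ.∣_)
    (sym (trans (sum-filter-tabulate (λ v → colour v ≟ᶜ black) (λ v → v) (λ v → ⟦ lookup C v ⟧ * adjacency G w v))
                (sum-cong-≗ drop-indicator)))
    (isChannel⇒evenKernel G channel w)
    where
    w = List.lookup (verticesOf G colour white) i
    drop-indicator : ∀ v → ⟦ does (colour v ≟ᶜ black) ⟧ * (⟦ lookup C v ⟧ * adjacency G w v) ≡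
                         ⟦ lookup C v ⟧ * adjacency G w v
    drop-indicator v with lookup C v in v∈?C
    ... | false = ℤ.*-zeroʳ ⟦ does (colour v ≟ᶜ black) ⟧
    ... | true  = trans
      (cong (λ b → ⟦ b ⟧ * (1ℤ * adjacency G w v))
            (dec-true (colour v ≟ᶜ black) (blackOnly v (lookup⇒[]= v C v∈?C))))
      (ℤ.*-identityˡ _)

  -- At a vertex that is not black every `C a` is zero, so a relation on the black coordinates is a
  -- relation everywhere.
  blackChannels-independent : ∀ {n} (C : Vector (Subset N) n) → (∀ a → IsBlackChannel G colour (C a)) →
    Independent (λ a → lookup (C a)) → Independent (λ a j → lookup (C a) (List.lookup blacks j))
  blackChannels-independent {n} C channels ind ε vanishes = ind ε vanishes-everywhere
    where
    vanishes-everywhere : ∀ v → F₂.sum (λ a → ε a ∧ lookup (C a) v) ≡ false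
    vanishes-everywhere v with colour v ≟ᶜ black
    ... | yes v-black = subst (λ u → F₂.sum (λ a → ε a ∧ lookup (C a) u) ≡ false)
      (sym (lookup-index v∈blacks)) (vanishes (index v∈blacks))
      where v∈blacks = ∈-filter⁺ (λ v → colour v ≟ᶜ black) (∈-allFin v) v-black
    ... | no v-white = trans (F₂.sum-cong-≗ λ a → trans (cong (ε a ∧_) (outside-C a)) (Bool.∧-zeroʳ (ε a)))
                             (F₂.sum-replicate-zero n)
      where
      outside-C : ∀ a → lookup (C a) v ≡ false
      outside-C a = Bool.¬-not λ v∈C → v-white (proj₂ (channels a) v (lookup⇒[]= v (C a) v∈C))

  -- Both colour classes have as many vertices as M has edges, since every edge has one endpoint of each colour.
  perfectMatching⇒balanced : IsProperColouring G colour → ∀ M → IsPerfectMatching G M →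
                             #white G colour ≡ #black G colour
  perfectMatching⇒balanced proper M perfect =
    ℤ.+-injective (trans (colourClass-size white) (sym (colourClass-size black)))
    where
    E = length (edges G)
    endpoints : Fin E → Fin N × Fin N
    endpoints = List.lookup (edges G)
    endpoint? : ∀ v (e : Fin E) → Dec (v ≡ proj₁ (endpoints e) ⊎ v ≡ proj₂ (endpoints e))
    endpoint? v e = (v ≟ proj₁ (endpoints e)) ⊎-dec (v ≟ proj₂ (endpoints e))

    matched-once : ∀ v → 1ℤ ≡ ∑[ e < E ] (⟦ lookup M e ⟧ * ⟦ does (endpoint? v e) ⟧)
    matched-once v = begin
      1ℤ                                ≡⟨ cong +_ (perfect v) ⟨
      + ∣ M ∩ edgesAt G v ∣             ≡⟨ cong (λ p → + ∣ p ∣) (∩-comm M (edgesAt G v)) ⟩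
      + ∣ edgesAt G v ∩ M ∣             ≡⟨ ∣tabulate∩∣ (λ e → does (endpoint? v e)) M ⟩
      ∑[ e < E ] (⟦ lookup M e ⟧ * ⟦ does (endpoint? v e) ⟧) ∎

    adjacent : ∀ e → T (adj (proj₁ (endpoints e)) (proj₂ (endpoints e)))
    adjacent e = proj₂ (All.lookup (all-filter _ (List.cartesianProduct (allFin N) (allFin N)))
                                   (∈-lookup {xs = edges G} e))

    one-endpoint : ∀ c e → ∑[ v < N ] (⟦ does (colour v ≟ᶜ c) ⟧ * ⟦ does (endpoint? v e) ⟧) ≡ 1ℤ
    one-endpoint c e with otherColour (proper (proj₁ (endpoints e)) (proj₂ (endpoints e)) (adjacent e)) c
    ... | inj₁ (u-c , w-¬c) = sum-unique (λ v → colour v ≟ᶜ c) (λ v → endpoint? v e) (proj₁ (endpoints e)) u-c (inj₁ refl)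
      λ { v v-c (inj₁ v≡u) → v≡u ; v v-c (inj₂ refl) → contradiction v-c w-¬c }
    ... | inj₂ (w-c , u-¬c) = sum-unique (λ v → colour v ≟ᶜ c) (λ v → endpoint? v e) (proj₂ (endpoints e)) w-c (inj₂ refl)
      λ { v v-c (inj₁ refl) → contradiction v-c u-¬c ; v v-c (inj₂ v≡w) → v≡w }
    colourClass-size : ∀ c → + length (verticesOf G colour c) ≡ ∑[ e < E ] ⟦ lookup M e ⟧
    colourClass-size c = begin
      + length (verticesOf G colour c)
        ≡⟨ sum-1 _ ⟨
      ∑[ _ < length (verticesOf G colour c) ] 1ℤ
        ≡⟨ sum-filter-tabulate (λ v → colour v ≟ᶜ c) (λ v → v) (λ _ → 1ℤ) ⟩
      ∑[ v < N ] (χ v * 1ℤ)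
        ≡⟨ sum-cong-≗ (λ v → trans (cong (χ v *_) (matched-once v))
                                   (*-distribˡ-sum (χ v) λ e → ⟦ lookup M e ⟧ * incidence v e)) ⟩
      ∑[ v < N ] ∑[ e < E ] (χ v * (⟦ lookup M e ⟧ * incidence v e))
        ≡⟨ ∑-comm (λ v e → χ v * (⟦ lookup M e ⟧ * incidence v e)) ⟩
      ∑[ e < E ] ∑[ v < N ] (χ v * (⟦ lookup M e ⟧ * incidence v e))
        ≡⟨ sum-cong-≗ (λ e → trans (sum-cong-≗ λ v → exchange (χ v) ⟦ lookup M e ⟧ (incidence v e))
                                   (sym (*-distribˡ-sum ⟦ lookup M e ⟧ λ v → χ v * incidence v e))) ⟩
      ∑[ e < E ] (⟦ lookup M e ⟧ * ∑[ v < N ] (χ v * incidence v e))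
        ≡⟨ sum-cong-≗ (λ e → trans (cong (⟦ lookup M e ⟧ *_) (one-endpoint c e)) (ℤ.*-identityʳ ⟦ lookup M e ⟧)) ⟩
      ∑[ e < E ] ⟦ lookup M e ⟧ ∎
      where
      χ : Fin N → ℤ
      χ v = ⟦ does (colour v ≟ᶜ c) ⟧
      incidence : Fin N → Fin E → ℤ
      incidence v e = ⟦ does (endpoint? v e) ⟧
      exchange : ∀ x m y → x * (m * y) ≡ m * (x * y)
      exchange = solve-∀

theorem3p5 : ∀ {N : ℕ} (G : Graph N) → ∃ (IsKasteleynSigning G) →
    (∀ (n : ℕ) (C : Vector (Subset N) n) → (∀ i → IsChannel G (C i)) → LinearlyIndependent C →
    2 ^ n ∣ #perfectMatchings G ^ 2)
    × (#channels G ∣ #perfectMatchings G ^ 2)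
    × (∀ (colour : Fin N → Colour) → IsProperColouring G colour →
    ∃ (IsBipartiteKasteleynSigning G colour) →
    ∀ (n : ℕ) (C : Vector (Subset N) n) → (∀ i → IsBlackChannel G colour (C i)) → LinearlyIndependent C →
    2 ^ n ∣ #perfectMatchings G)
theorem3p5 {N} G (K , signing , detK≡m²) =
    (λ n C channels ind → independent-divides n C channels (linearlyIndependent⇒independent C ind))
  , #channels-divides
  , black-divides
  where
  -- Stated with `Independent` so as to cover both the given channels and a basis of the channel
  -- space.
  independent-divides : ∀ n (C : Vector (Subset N) n) → (∀ a → IsChannel G (C a)) →
                        Independent (λ a → lookup (C a)) → 2 ^ n ∣ #perfectMatchings G ^ 2
  independent-divides n C channels ind = ℤ.∣⇒∣ᵤ (subst (+ (2 ^ n) ℤ.∣_) detK≡m²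
    (2^n∣det K (λ a → lookup (C a)) ind
      λ a → evenKernel-signing {c = lookup (C a)} signing (isChannel⇒evenKernel G {C a} (channels a))))

  #channels-divides : #channels G ∣ #perfectMatchings G ^ 2
  #channels-divides =
    -- A basis of size `k` gives `2 ^ k` channels, so the divisibility for this basis is the one for
    -- the number of channels.
    let k , C , channels , ind , #≡2^k = subspaceBasis N (isChannel? G) (isChannel-⊥ G)
                                           (λ {C} {D} → isChannel-△ G {C} {D})
    in subst (_∣ #perfectMatchings G ^ 2) (sym #≡2^k) (independent-divides k C channels ind)

  black-divides : ∀ colour → IsProperColouring G colour → ∃ (IsBipartiteKasteleynSigning G colour) →
    ∀ n (C : Vector (Subset N) n) → (∀ a → IsBlackChannel G colour (C a)) → LinearlyIndependent C →
    2 ^ n ∣ #perfectMatchings G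
  black-divides colour proper (H , signingH , detH≡m) n C channels ind
    with #white G colour ℕ.≟ #black G colour
  -- Classes of different sizes leave no perfect matching, and 0 is divisible by everything.
  ... | no unbalanced = subst (2 ^ n ∣_)
    (sym (#subsets-none (isPerfectMatching? G) λ M perfect →
           unbalanced (perfectMatching⇒balanced G colour proper M perfect)))
    ((2 ^ n) ∣0)
  ... | yes square = ℤ.∣⇒∣ᵤ (subst (+ (2 ^ n) ℤ.∣_) (detH≡m square)
    (2^n∣det (λ i j → H i (cast square j)) (λ a j → c a (cast square j)) ind-cast kernel-cast))
    where
    c : Fin n → Vector Bool (#black G colour)
    c a j = lookup (C a) (List.lookup (verticesOf G colour black) j)
    kernel-cast : ∀ a → EvenKernel (λ i j → H i (cast square j)) (λ j → c a (cast square j))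
    kernel-cast a i = subst (+ 2 ℤ.∣_) (sym (sum-cast square λ j → ⟦ c a j ⟧ * H i j))
      (evenKernel-signing {c = c a} signingH (isBlackChannel⇒evenKernel G colour {C a} (channels a)) i)
    ind-cast : Independent (λ a j → c a (cast square j))
    -- `vanishes` speaks of positions of the form `cast square k`; every black position `j` has this
    -- form, with `k` its cast back.
    ind-cast ε vanishes = blackChannels-independent G colour C channels (linearlyIndependent⇒independent C ind) ε
      λ j → subst (λ j → F₂.sum (λ a → ε a ∧ c a j) ≡ false) (Fin.cast-involutive square (sym square) j)
                  (vanishes (cast (sym square) j))
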